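{- Let $G$ be a graph of order $n\ge 2$ with $\gamma_2(G)\ge 2$ and $\gamma_2(\overline{G})\ge 2$, where $\overline{G}$ is the complement of $G$. Then $st_{\gamma_2}(G)+st_{\gamma_2}(\overline{G})\le 2n-2$.
   Context: All graphs are finite, simple and undirected. For a graph $G=(V,E)$, a subset $D \subseteq V$ is a 2-dominating set if every vertex $v \in V \setminus D$ has at least two neighbors in $D$. The 2-domination number $\gamma_2(G)$ is the minimum cardinality of a 2-dominating set of $G$. The stability of the 2-domination number, $st_{\gamma_2}(G)$, is the minimum number of vertices whose removal from $G$ (deleting the vertices and all incident edges) changes the 2-domination number, i.e. the minimum of $|S|$ over $S\subseteq V$ with $\gamma_2(G-S)\ne\gamma_2(G)$. -}

module Defs where

open import Data.Bool.Base using (true; false)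
open import Data.Fin.Base using (Fin; zero; suc; fromℕ<)
open import Data.Fin.Properties using (all?) renaming (_≟_ to _≟ᶠ_)
open import Data.Fin.Subset using (Subset; _∈_; _∉_; _∩_; ∁; ⊤; ∣_∣)
open import Data.Fin.Subset.Properties
open import Data.Nat.Base using (ℕ; _≤_; _<_; s≤s; z≤n)
open import Data.Nat.Induction using (<-wellFounded)
open import Data.Nat.Properties
open import Data.Product.Base using (∃; _×_; _,_)
open import Data.Vec.Base using ([]; _∷_; tabulate)
open import Function.Base using (_∘_)
open import Induction.WellFounded using (Acc; acc)
open import Level using (0ℓ)
open import Relation.Binary.Core using (Rel)
open import Relation.Binary.Definitions using (Symmetric; Irreflexive)
  renaming (Decidable to Decidable₂)
open import Relation.Binary.PropositionalEquality
  using (_≡_; _≢_; sym; trans; cong; subst)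
open import Relation.Nullary.Decidable
  using (Dec; yes; no; does; ¬?; _×-dec_; _→-dec_)
open import Relation.Nullary.Negation using (¬_; contradiction)
open import Relation.Unary using (Pred; Decidable)

-- Finite simple graphs of order n, on the vertex set Fin n.
record Graph (n : ℕ) : Set₁ where
  field
    Adj        : Rel (Fin n) 0ℓ
    adj?       : Decidable₂ Adj
    adj-sym    : Symmetric Adj
    adj-irrefl : Irreflexive _≡_ Adj

open Graph public

complement : ∀ {n} → Graph n → Graph n
complement G = record
  { Adj        = λ u v → u ≢ v × ¬ Adj G u v
  ; adj?       = λ u v → ¬? (u ≟ᶠ v) ×-dec ¬? (adj? G u v)
  ; adj-sym    = λ { (u≢v , ¬uv) → (u≢v ∘ sym) , (¬uv ∘ adj-sym G) }
  ; adj-irrefl = λ { u≡v (u≢v , _) → u≢v u≡v }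
  }

-- The elements of p in increasing order; a bijection from Fin ∣ p ∣ onto p.
nth : ∀ {n} (p : Subset n) → Fin ∣ p ∣ → Fin n
nth (true  ∷ p) zero    = zero
nth (true  ∷ p) (suc i) = suc (nth p i)
nth (false ∷ p) i       = suc (nth p i)

-- G ∖ S is the induced subgraph on the complement of S, with its vertices
-- renumbered so that it is again a graph on an initial segment.
infixl 6 _∖_
_∖_ : ∀ {n} → Graph n → (S : Subset n) → Graph ∣ ∁ S ∣
G ∖ S = record
  { Adj        = λ i j → Adj G (nth (∁ S) i) (nth (∁ S) j)
  ; adj?       = λ i j → adj? G (nth (∁ S) i) (nth (∁ S) j)
  ; adj-sym    = adj-sym G
  ; adj-irrefl = λ i≡j → adj-irrefl G (cong (nth (∁ S)) i≡j)
  }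

neighbours : ∀ {n} → Graph n → Fin n → Subset n
neighbours G v = tabulate (λ u → does (adj? G v u))

TwoDominating : ∀ {n} → Graph n → Pred (Subset n) 0ℓ
TwoDominating G D = ∀ v → v ∉ D → 2 ≤ ∣ neighbours G v ∩ D ∣

twoDominating? : ∀ {n} (G : Graph n) → Decidable (TwoDominating G)
twoDominating? G D =
  all? λ v → ¬? (v ∈? D) →-dec (2 ≤? ∣ neighbours G v ∩ D ∣)

record Smallest {n} (P : Pred (Subset n) 0ℓ) : Set where
  field
    set      : Subset n
    holds    : P set
    smallest : ∀ q → P q → ∣ set ∣ ≤ ∣ q ∣

  cardinality : ℕ
  cardinality = ∣ set ∣

smallest : ∀ {n} {P : Pred (Subset n) 0ℓ} → Decidable P → ∃ P → Smallest P
smallest {P = P} P? (p , Pp) = go p Pp (<-wellFounded ∣ p ∣)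
  where
  go : ∀ p → P p → Acc _<_ ∣ p ∣ → Smallest P
  go p Pp (acc rec)
    with anySubset? (λ q → P? q ×-dec (∣ q ∣ <? ∣ p ∣))
  ... | yes (q , Pq , q<p) = go q Pq (rec q<p)
  ... | no  ∄q = record
    { set      = p
    ; holds    = Pp
    ; smallest = λ q Pq → ≮⇒≥ λ q<p → ∄q (q , Pq , q<p)
    }

⊤-twoDominating : ∀ {n} (G : Graph n) → TwoDominating G ⊤
⊤-twoDominating G v v∉⊤ = contradiction ∈⊤ v∉⊤

minTwoDominating : ∀ {n} (G : Graph n) → Smallest (TwoDominating G)
minTwoDominating G = smallest (twoDominating? G) (⊤ , ⊤-twoDominating G)

γ₂ : ∀ {n} → Graph n → ℕ
γ₂ G = Smallest.cardinality (minTwoDominating G)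

γ₂≤order : ∀ {n} (G : Graph n) → γ₂ G ≤ n
γ₂≤order G = ∣p∣≤n (Smallest.set (minTwoDominating G))

γ₂>0 : ∀ {n} (G : Graph n) → 0 < n → 0 < γ₂ G
γ₂>0 {n} G 0<n with fromℕ< 0<n ∈? D
  where D = Smallest.set (minTwoDominating G)
... | yes v∈D = m<n⇒0<n (x∈p⇒∣p-x∣<∣p∣ v∈D)
... | no  v∉D = ≤-trans (s≤s z≤n)
  (≤-trans (Smallest.holds (minTwoDominating G) v v∉D)
           (∣p∩q∣≤∣q∣ (neighbours G v) _))
  where v = fromℕ< 0<n

Changesγ₂ : ∀ {n} → Graph n → Pred (Subset n) 0ℓ
Changesγ₂ G S = γ₂ (G ∖ S) ≢ γ₂ G

⊤-changes : ∀ {n} (G : Graph n) → 0 < n → Changesγ₂ G ⊤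
⊤-changes {n} G 0<n = <⇒≢ (≤-<-trans γ₂≤0 (γ₂>0 G 0<n))
  where
  order≡0 : ∣ ∁ (⊤ {n}) ∣ ≡ 0
  order≡0 = trans (∣∁p∣≡n∸∣p∣ (⊤ {n}))
              (m≤n⇒m∸n≡0 (≤-reflexive (sym (∣⊤∣≡n n))))

  γ₂≤0 : γ₂ (G ∖ ⊤) ≤ 0
  γ₂≤0 = subst (γ₂ (G ∖ ⊤) ≤_) order≡0 (γ₂≤order (G ∖ ⊤))

-- Nonemptiness guarantees that some S (namely all of V) changes γ₂, the null
-- graph having γ₂ = 0; for the null graph itself the stability is undefined.
minChange : ∀ {n} (G : Graph n) → 0 < n → Smallest (Changesγ₂ G)
minChange G 0<n =
  smallest (λ S → ¬? (γ₂ (G ∖ S) ≟ γ₂ G)) (⊤ , ⊤-changes G 0<n)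

stγ₂ : ∀ {n} → Graph n → 0 < n → ℕ
stγ₂ G 0<n = Smallest.cardinality (minChange G 0<n)

{-# OPTIONS --safe #-}
-- Deleting all vertices but one leaves a graph of order 1, whose 2-domination
-- number is at most 1.  So γ₂ ≥ 2 forces stγ₂ ≤ n − 1, and this applies both to
-- G and to its complement.
module Submission where

open import Defs
open import Data.Fin.Base using (fromℕ<)
open import Data.Fin.Subset using (∁; ⁅_⁆; ∣_∣)
open import Data.Fin.Subset.Properties using (∣⁅x⁆∣≡1; ∣∁p∣≡n∸∣p∣; ∣p∣≤n)
open import Data.Nat.Base using (ℕ; _+_; _*_; _∸_; _≤_; _<_)
open import Data.Nat.Properties
  using (m<n⇒0<n; ≤-refl; <⇒≢; <-≤-trans; +-mono-≤; +-identityʳ; *-distribˡ-∸; m∸[m∸n]≡n;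
         module ≤-Reasoning)
open import Relation.Binary.PropositionalEquality using (cong; sym)

-- Stability is a minimum, so one set that changes `γ₂` bounds it from above. The set `∁ ⁅ v ⁆` has
-- `n ∸ 1` elements and brings `γ₂` below 2; adding the bounds for the two graphs gives the claim.

γ₂-deletion-< : ∀ {n} (G : Graph n) v → γ₂ (G ∖ ∁ ⁅ v ⁆) < 2
γ₂-deletion-< {n} G v = begin-strict
  γ₂ (G ∖ ∁ ⁅ v ⁆)     ≤⟨ γ₂≤order (G ∖ ∁ ⁅ v ⁆) ⟩
  -- The double complement is only counted, not rewritten to `⁅ v ⁆`.
  ∣ ∁ (∁ ⁅ v ⁆) ∣      ≡⟨ ∣∁p∣≡n∸∣p∣ (∁ ⁅ v ⁆) ⟩
  n ∸ ∣ ∁ ⁅ v ⁆ ∣      ≡⟨ cong (n ∸_) (∣∁p∣≡n∸∣p∣ ⁅ v ⁆) ⟩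
  n ∸ (n ∸ ∣ ⁅ v ⁆ ∣)  ≡⟨ m∸[m∸n]≡n (∣p∣≤n ⁅ v ⁆) ⟩
  ∣ ⁅ v ⁆ ∣            ≡⟨ ∣⁅x⁆∣≡1 v ⟩
  1                    <⟨ ≤-refl ⟩
  2                    ∎
  where open ≤-Reasoning

stγ₂≤n∸1 : ∀ {n} (G : Graph n) (0<n : 0 < n) → 2 ≤ γ₂ G → stγ₂ G 0<n ≤ n ∸ 1
stγ₂≤n∸1 {n} G 0<n 2≤γ₂ = begin
  stγ₂ G 0<n     ≤⟨ Smallest.smallest (minChange G 0<n) (∁ ⁅ v ⁆) changes ⟩
  ∣ ∁ ⁅ v ⁆ ∣    ≡⟨ ∣∁p∣≡n∸∣p∣ ⁅ v ⁆ ⟩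
  n ∸ ∣ ⁅ v ⁆ ∣  ≡⟨ cong (n ∸_) (∣⁅x⁆∣≡1 v) ⟩
  n ∸ 1          ∎
  where
  open ≤-Reasoning
  -- The surviving vertex is arbitrary; vertex 0 exists because `0 < n`.
  v = fromℕ< 0<n

  changes : Changesγ₂ G (∁ ⁅ v ⁆)
  changes = <⇒≢ (<-≤-trans (γ₂-deletion-< G v) 2≤γ₂)

theorem3p7 : (n : ℕ) (2≤n : 2 ≤ n) (G : Graph n) →
    2 ≤ γ₂ G → 2 ≤ γ₂ (complement G) →
    stγ₂ G (m<n⇒0<n 2≤n) + stγ₂ (complement G) (m<n⇒0<n 2≤n) ≤ 2 * n ∸ 2
theorem3p7 n 2≤n G 2≤γ₂G 2≤γ₂Gᶜ = begin
  stγ₂ G 0<n + stγ₂ (complement G) 0<n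
    ≤⟨ +-mono-≤ (stγ₂≤n∸1 G 0<n 2≤γ₂G) (stγ₂≤n∸1 (complement G) 0<n 2≤γ₂Gᶜ) ⟩
  -- `2 * k` unfolds to `k + (k + 0)`, hence the added zero.
  (n ∸ 1) + (n ∸ 1)  ≡⟨ cong ((n ∸ 1) +_) (sym (+-identityʳ (n ∸ 1))) ⟩
  2 * (n ∸ 1)        ≡⟨ *-distribˡ-∸ 2 n 1 ⟩
  2 * n ∸ 2          ∎
  where
  open ≤-Reasoning
  0<n = m<n⇒0<n 2≤n
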